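{- There is $n_0$ such that for all $n\ge n_0$ and every integer $b \geq 200\, n\ln n$ the following holds: in the monotone $(1:b)$ Avoider-Enforcer game on $E(K_n)$, and also in the strict $(1:b)$ Avoider-Enforcer game on $E(K_n)$, Avoider has a strategy ensuring that at the end of the game Avoider's graph is a forest plus at most one additional edge, i.e.\ it can be obtained from a forest on the vertex set of $K_n$ by adding at most one edge.
   Context: Avoider-Enforcer games on $E(K_n)$: two players, Avoider (who moves first) and Enforcer, alternately claim previously unclaimed edges of the complete graph $K_n$ until all edges are claimed; Avoider's graph is the graph on $V(K_n)$ formed by the edges he claimed. In the strict $(1:b)$ game, in each turn Avoider claims exactly $1$ unclaimed edge and Enforcer claims exactly $b$ unclaimed edges; if fewer than $b$ unclaimed edges remain at Enforcer's turn, he claims all of them. In the monotone $(1:b)$ game, in each turn Avoider claims at least $1$ and Enforcer at least $b$ unclaimed edges (again, if fewer than $b$ remain at Enforcer's turn, he claims all of them). $\ln$ denotes the natural logarithm. -}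

module Defs where

open import Data.Nat using (ℕ; zero; suc; _+_; _*_; _^_; _≤_; _<_; _!)
open import Data.Fin using (Fin) renaming (_<?_ to _<ᶠ?_)
open import Data.Fin.Subset using (Subset; _∈_; _⊆_; ∣_∣; ∁; _∪_; Nonempty; Empty)
open import Data.List using (List; []; _∷_; _++_; length; filter; cartesianProduct; allFin; lookup)
open import Data.List.Relation.Unary.Linked using (Linked)
open import Data.List.Relation.Unary.Unique.Propositional using (Unique)
open import Data.Product using (Σ; ∃; ∃-syntax; _×_; _,_; proj₁; proj₂)
open import Data.Sum using (_⊎_)
open import Relation.Binary.PropositionalEquality using (_≡_)
open import Relation.Nullary using (¬_)

edgeList : (n : ℕ) → List (Fin n × Fin n)
edgeList n = filter (λ p → proj₁ p <ᶠ? proj₂ p) (cartesianProduct (allFin n) (allFin n))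

M : ℕ → ℕ
M n = length (edgeList n)

Edge : ℕ → Set
Edge n = Fin (M n)

ends : (n : ℕ) → Edge n → Fin n × Fin n
ends n e = lookup (edgeList n) e

EdgeSet : ℕ → Set
EdgeSet n = Subset (M n)

Adj : (n : ℕ) → EdgeSet n → Fin n → Fin n → Set
Adj n F u v = ∃[ e ] (e ∈ F × (ends n e ≡ (u , v) ⊎ ends n e ≡ (v , u)))

HasCycle : (n : ℕ) → EdgeSet n → Set
HasCycle n F = ∃[ v ] ∃[ ws ]
  (2 ≤ length ws × Unique (v ∷ ws) × Linked (Adj n F) (v ∷ ws ++ (v ∷ [])))

Forest : (n : ℕ) → EdgeSet n → Set
Forest n F = ¬ HasCycle n F

ForestPlusOne : (n : ℕ) → EdgeSet n → Set
ForestPlusOne n A = ∃[ F ] (F ⊆ A × Forest n F × ∣ A ∣ ≤ ∣ F ∣ + 1)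

data Variant : Set where
  strict monotone : Variant

data Turn : Set where
  avoider enforcer : Turn

Free : (n : ℕ) → EdgeSet n → EdgeSet n → EdgeSet n
Free n A E = ∁ (A ∪ E)

AvLegal : (n : ℕ) → Variant → EdgeSet n → EdgeSet n → EdgeSet n → Set
AvLegal n strict   A E S = S ⊆ Free n A E × ∣ S ∣ ≡ 1
AvLegal n monotone A E S = S ⊆ Free n A E × 1 ≤ ∣ S ∣

EnfLegal : (n : ℕ) → Variant → ℕ → EdgeSet n → EdgeSet n → EdgeSet n → Set
EnfLegal n v b A E S =
  S ⊆ Free n A E ×
  ((∣ Free n A E ∣ < b × S ≡ Free n A E) ⊎ (b ≤ ∣ Free n A E ∣ × Size v))
  where
  Size : Variant → Set
  Size strict   = ∣ S ∣ ≡ b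
  Size monotone = b ≤ ∣ S ∣

data AvoiderForces (n : ℕ) (v : Variant) (b : ℕ) (P : EdgeSet n → Set)
     : EdgeSet n → EdgeSet n → Turn → Set where
  finished : ∀ {A E t} → Empty (Free n A E) → P A →
             AvoiderForces n v b P A E t
  avMove   : ∀ {A E} → Nonempty (Free n A E) → (S : EdgeSet n) →
             AvLegal n v A E S →
             AvoiderForces n v b P (A ∪ S) E enforcer →
             AvoiderForces n v b P A E avoider
  enfMove  : ∀ {A E} → Nonempty (Free n A E) →
             ((S : EdgeSet n) → EnfLegal n v b A E S →
                AvoiderForces n v b P A (E ∪ S) avoider) →
             AvoiderForces n v b P A E enforcer

AvoiderCanEnsure : (n : ℕ) → Variant → ℕ → (EdgeSet n → Set) → Set
AvoiderCanEnsure n v b P =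
  AvoiderForces n v b P Data.Fin.Subset.⊥ Data.Fin.Subset.⊥ avoider

-- The condition b ≥ 200 n ln n.
-- expT b K = K! · Σ_{k=0}^{K} b^k / k!   (an integer)
expT : ℕ → ℕ → ℕ
expT b zero    = 1
expT b (suc K) = suc K * expT b K + b ^ suc K

-- b ≥ 200 n ln n  ⟺  n^(200 n) ≤ e^b  ⟺  ∃ K. n^(200 n) ≤ Σ_{k≤K} b^k/k!
BiasAtLeast200nlnn : ℕ → ℕ → Set
BiasAtLeast200nlnn n b = ∃[ K ] (n ^ (200 * n) * K ! ≤ expT b K)

{-# OPTIONS --safe #-}

{-
Give a vertex in a component of size s of Avoider's forest the weight 2^s, let W be the
sum of all weights, and let Φ be the sum, over the free edges joining two components, of
the product of the weights of the two ends. While such an edge exists Avoider claims one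
of minimum product P. If k is the size of the component created, then P = 2^k, so the
move raises every weight inside that component to P: W grows by at most P k and Φ by at
most 2 P k W. In reply Enforcer claims at least b free edges, of which at most W lie inside
components (s ≤ 2^s), and each of the others removes at least P from Φ. Since P ≤ Φ, k is
O(log n); hence for b ≥ 200 n ln n the quantity Φ + 4 n W never grows, and W stays ≤ 3 n.
When no free edge joins two components, fewer than b edges are free, so Avoider closes
at most one cycle before Enforcer takes everything that is left.
-}

module Submission where

open import Defs
open import Data.Bool using (true; false; if_then_else_)
open import Data.Fin using (Fin; zero; suc; _≟_)
open import Data.Fin.Subset using (Subset; _∈_; _∉_; _⊆_; ∣_∣; _∪_; ⁅_⁆; Empty) renaming (⊥ to ∅)
open import Data.Fin.Subset.Properties
open import Data.List using (List; []; _∷_; _++_; map; filter; cartesianProduct; allFin; tabulate; lookup; length)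
open import Data.List.Membership.Propositional using () renaming (_∈_ to _∈ˡ_)
open import Data.List.Relation.Unary.All as All using (All; []; _∷_)
open import Data.List.Relation.Unary.AllPairs using ([]; _∷_)
open import Data.List.Relation.Unary.Any using (here; there)
open import Data.List.Relation.Unary.Linked using (Linked; []; [-]; _∷_)
open import Data.List.Relation.Unary.Unique.Propositional using (Unique)
open import Data.Nat using (ℕ; zero; suc; _+_; _*_; _^_; _≤_; _<_; _!; z≤n; s≤s; NonZero; >-nonZero; >-nonZero⁻¹)
open import Data.Nat.Properties hiding (_≟_)
open import Data.Nat.Tactic.RingSolver using (solve-∀)
open import Data.Product using (∃-syntax; _×_; _,_; proj₁; proj₂)
open import Data.Sum using (_⊎_; inj₁; inj₂; [_,_]′)
import Data.Vec as Vec
open import Data.Vec.Properties using (lookup⇒[]=; []=⇒lookup)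
open import Algebra.Properties.Semiring.Sum +-*-semiring
  using (sum; sum-syntax; sum-cong-≗; ∑-distrib-+; ∑-comm; *-distribˡ-sum; *-distribʳ-sum)
open import Function using (_∘_; id)
open import Relation.Binary.PropositionalEquality
open import Relation.Nullary using (Dec; yes; no; does; contradiction; ¬_; _×-dec_; ¬?)
open import Relation.Unary using (Pred; Decidable)

-- Finite sums, minima and indicator functions.

sum-mono-≤ : ∀ {n} {f g : Fin n → ℕ} → (∀ i → f i ≤ g i) → sum f ≤ sum g
sum-mono-≤ {zero}  f≤g = z≤n
sum-mono-≤ {suc n} f≤g = +-mono-≤ (f≤g zero) (sum-mono-≤ (f≤g ∘ suc))

term≤sum : ∀ {n} (f : Fin n → ℕ) i → f i ≤ sum f
term≤sum f zero    = m≤m+n _ _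
term≤sum f (suc i) = ≤-trans (term≤sum (f ∘ suc) i) (m≤n+m _ _)

sum-≤-const : ∀ {n} {f : Fin n → ℕ} {a} → (∀ i → f i ≤ a) → sum f ≤ n * a
sum-≤-const {zero}  f≤a = z≤n
sum-≤-const {suc n} f≤a = +-mono-≤ (f≤a zero) (sum-≤-const (f≤a ∘ suc))

sum-linear : ∀ {n} (f g : Fin n → ℕ) a → ∑[ i < n ] (f i + a * g i) ≡ sum f + a * sum g
sum-linear f g a = trans (∑-distrib-+ f _) (cong (sum f +_) (sym (*-distribˡ-sum a g)))

module _ {A : Set} (g : A → ℕ) where

  sum-lookup-filter : ∀ {p} {P : Pred A p} (P? : Decidable P) xs →
    sum (g ∘ lookup (filter P? xs)) ≤ sum (g ∘ lookup xs)
  sum-lookup-filter P? [] = z≤n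
  sum-lookup-filter P? (x ∷ xs) with does (P? x)
  ... | true  = +-monoʳ-≤ (g x) (sum-lookup-filter P? xs)
  ... | false = ≤-trans (sum-lookup-filter P? xs) (m≤n+m _ (g x))

  sum-lookup-++ : ∀ xs ys →
    sum (g ∘ lookup (xs ++ ys)) ≡ sum (g ∘ lookup xs) + sum (g ∘ lookup ys)
  sum-lookup-++ []       ys = refl
  sum-lookup-++ (x ∷ xs) ys =
    trans (cong (g x +_) (sum-lookup-++ xs ys)) (sym (+-assoc (g x) _ _))

  sum-lookup-map : ∀ {B : Set} (f : B → A) xs →
    sum (g ∘ lookup (map f xs)) ≡ sum (g ∘ f ∘ lookup xs)
  sum-lookup-map f []       = refl
  sum-lookup-map f (x ∷ xs) = cong (g (f x) +_) (sum-lookup-map f xs)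

  sum-lookup-tabulate : ∀ {n} (f : Fin n → A) →
    sum (g ∘ lookup (tabulate f)) ≡ sum (g ∘ f)
  sum-lookup-tabulate {zero}  f = refl
  sum-lookup-tabulate {suc n} f = cong (g (f zero) +_) (sum-lookup-tabulate (f ∘ suc))

sum-lookup-cartesianProduct : ∀ {A B : Set} (g : A × B → ℕ) xs ys →
  sum (g ∘ lookup (cartesianProduct xs ys)) ≡
  sum (λ i → sum (λ j → g (lookup xs i , lookup ys j)))
sum-lookup-cartesianProduct g []       ys = refl
sum-lookup-cartesianProduct g (x ∷ xs) ys =
  trans (sum-lookup-++ g (map (x ,_) ys) (cartesianProduct xs ys))
        (cong₂ _+_ (sum-lookup-map g (x ,_) ys) (sum-lookup-cartesianProduct g xs ys))

-- Edges are the pairs with increasing ends among all ordered pairs, so filtering only drops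
-- nonnegative terms. Sums over all ordered pairs factor, which sums over edges do not.
sum-ends : ∀ n (g : Fin n × Fin n → ℕ) →
  ∑[ e < M n ] g (ends n e) ≤ ∑[ x < n ] ∑[ y < n ] g (x , y)
sum-ends n g = begin
  ∑[ e < M n ] g (ends n e)
    ≤⟨ sum-lookup-filter g _ (cartesianProduct (allFin n) (allFin n)) ⟩
  sum (g ∘ lookup (cartesianProduct (allFin n) (allFin n)))
    ≡⟨ sum-lookup-cartesianProduct g (allFin n) (allFin n) ⟩
  sum (λ i → sum (λ j → g (lookup (allFin n) i , lookup (allFin n) j)))
    ≡⟨ sum-lookup-tabulate (λ x → sum (λ j → g (x , lookup (allFin n) j))) id ⟩
  ∑[ x < n ] sum (λ j → g (x , lookup (allFin n) j))
    ≡⟨ sum-cong-≗ (λ x → sum-lookup-tabulate (λ y → g (x , y)) id) ⟩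
  ∑[ x < n ] ∑[ y < n ] g (x , y) ∎
  where open ≤-Reasoning

-- The two outcomes become the two phases of Avoider's play: join two components as cheaply as
-- possible, or find that no free edge joins two.
argmin : ∀ {m p} {P : Pred (Fin m) p} → Decidable P → (f : Fin m → ℕ) →
  (∃[ i ] (P i × (∀ j → P j → f i ≤ f j))) ⊎ (∀ i → ¬ P i)
argmin {zero}  P? f = inj₂ λ ()
argmin {suc m} P? f with P? zero | argmin (P? ∘ suc) (f ∘ suc)
... | no ¬p | inj₂ none = inj₂ λ { zero → ¬p ; (suc i) → none i }
... | no ¬p | inj₁ (i , pi , min) =
  inj₁ (suc i , pi , λ { zero p → contradiction p ¬p ; (suc j) → min j })
... | yes p | inj₂ none =
  inj₁ (zero , p , λ { zero _ → ≤-refl ; (suc j) q → contradiction q (none j) })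
... | yes p | inj₁ (i , pi , min) with ≤-total (f zero) (f (suc i))
...   | inj₁ 0≤i = inj₁ (zero , p , λ { zero _ → ≤-refl ; (suc j) q → ≤-trans 0≤i (min j q) })
...   | inj₂ i≤0 = inj₁ (suc i , pi , λ { zero _ → i≤0 ; (suc j) → min j })

χ : ∀ {m} → Subset m → Fin m → ℕ
χ p i = if Vec.lookup p i then 1 else 0

∣p∣≡∑χ : ∀ {m} (p : Subset m) → ∣ p ∣ ≡ sum (χ p)
∣p∣≡∑χ Vec.[]            = refl
∣p∣≡∑χ (true  Vec.∷ p) = cong suc (∣p∣≡∑χ p)
∣p∣≡∑χ (false Vec.∷ p) = ∣p∣≡∑χ p

⟦_⟧ : ∀ {p} {P : Set p} → Dec P → ℕ
⟦ d ⟧ = if does d then 1 else 0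

n≤2^n : ∀ n → n ≤ 2 ^ n
n≤2^n zero    = z≤n
n≤2^n (suc n) = +-mono-≤ (m^n>0 2 n) (≤-trans (n≤2^n n) (≤-reflexive (sym (+-identityʳ _))))

-- Weights of classes and their change when two classes merge.

module _ {n : ℕ} where

  -- Components are encoded by a labelling `c`: the class of a vertex consists of all vertices with
  -- its label. Joining components is then a relabelling, and no connectivity has to be computed.
  size : (Fin n → Fin n) → Fin n → ℕ
  size c x = ∑[ y < n ] ⟦ c y ≟ c x ⟧

  weight : (Fin n → Fin n) → Fin n → ℕ
  weight c x = 2 ^ size c x

  totalWeight : (Fin n → Fin n) → ℕ
  totalWeight c = sum (weight c)

  -- The value 0 inside a class lets the potential range over all free edges while only those
  -- between classes count.
  crossWeight : (Fin n → Fin n) → Fin n × Fin n → ℕ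
  crossWeight c (x , y) = if does (c x ≟ c y) then 0 else weight c x * weight c y

  crossPotential : (Fin n → Fin n) → EdgeSet n → ℕ
  crossPotential c F = ∑[ e < M n ] (χ F e * crossWeight c (ends n e))

  -- Each vertex `y` has `size c y` partners in its own class, and s ≤ 2^s.
  innerPairs≤totalWeight : ∀ c → ∑[ e < M n ] ⟦ c (proj₁ (ends n e)) ≟ c (proj₂ (ends n e)) ⟧ ≤ totalWeight c
  innerPairs≤totalWeight c = begin
    ∑[ e < M n ] ⟦ c (proj₁ (ends n e)) ≟ c (proj₂ (ends n e)) ⟧
      ≤⟨ sum-ends n (λ (x , y) → ⟦ c x ≟ c y ⟧) ⟩
    ∑[ x < n ] ∑[ y < n ] ⟦ c x ≟ c y ⟧
      ≡⟨ ∑-comm (λ x y → ⟦ c x ≟ c y ⟧) ⟩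
    sum (size c)
      ≤⟨ sum-mono-≤ (λ x → n≤2^n (size c x)) ⟩
    totalWeight c ∎
    where open ≤-Reasoning

  merge : (Fin n → Fin n) → Fin n → Fin n → Fin n → Fin n
  merge c u v x = if does (c x ≟ c v) then c u else c x

  module Merge (c : Fin n → Fin n) (u v : Fin n) (cu≢cv : c u ≢ c v) where

    c′ : Fin n → Fin n
    c′ = merge c u v

    mergedWeight : ℕ
    mergedWeight = weight c u * weight c v

    mergedSize : ℕ
    mergedSize = size c u + size c v

    -- The indicator of the new class: the two old classes are disjoint, so the sum never reaches 2.
    merged : Fin n → ℕ
    merged x = ⟦ c x ≟ c u ⟧ + ⟦ c x ≟ c v ⟧

    mergedWeight≡ : mergedWeight ≡ 2 ^ mergedSize
    mergedWeight≡ = sym (^-distribˡ-+-* 2 (size c u) (size c v))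

    ∑merged : sum merged ≡ mergedSize
    ∑merged = ∑-distrib-+ (λ x → ⟦ c x ≟ c u ⟧) (λ x → ⟦ c x ≟ c v ⟧)

    data Cases (x : Fin n) : Set where
      outside : merged x ≡ 0 → c′ x ≡ c x → weight c′ x ≤ weight c x → Cases x
      inside  : merged x ≡ 1 → c′ x ≡ c u → weight c′ x ≤ mergedWeight → Cases x

    size-inside : ∀ x → c′ x ≡ c u → size c′ x ≤ mergedSize
    size-inside x eq = ≤-trans (sum-mono-≤ pointwise) (≤-reflexive ∑merged)
      where
      pointwise : ∀ y → ⟦ c′ y ≟ c′ x ⟧ ≤ merged y
      pointwise y rewrite eq with c y ≟ c v
      ... | yes p with c u ≟ c u
      ...   | yes _ = m≤n+m 1 _
      ...   | no ¬q = contradiction refl ¬q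
      pointwise y | no ¬p = m≤m+n _ 0

    size-outside : ∀ x → c′ x ≡ c x → c x ≢ c u → size c′ x ≤ size c x
    size-outside x eq x≢u = sum-mono-≤ pointwise
      where
      pointwise : ∀ y → ⟦ c′ y ≟ c′ x ⟧ ≤ ⟦ c y ≟ c x ⟧
      pointwise y rewrite eq with c y ≟ c v
      ... | no _ = ≤-refl
      -- A vertex moved out of the class of `v` now carries the label `c u`, which differs from that
      -- of `x`.
      ... | yes _ with c u ≟ c x
      ...   | yes q = contradiction (sym q) x≢u
      ...   | no _  = z≤n

    cases : ∀ x → Cases x
    cases x with c x ≟ c u in equ | c x ≟ c v in eqv
    ... | yes p | yes q = contradiction (trans (sym p) q) cu≢cv
    ... | yes p | no ¬q = inside m≡ c≡ (≤-trans (^-monoʳ-≤ 2 (size-inside x c≡)) (≤-reflexive (sym mergedWeight≡)))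
      where
      m≡ : merged x ≡ 1
      m≡ rewrite equ | eqv = refl
      c≡ : c′ x ≡ c u
      c≡ rewrite eqv = p
    ... | no ¬p | yes q = inside m≡ c≡ (≤-trans (^-monoʳ-≤ 2 (size-inside x c≡)) (≤-reflexive (sym mergedWeight≡)))
      where
      m≡ : merged x ≡ 1
      m≡ rewrite equ | eqv = refl
      c≡ : c′ x ≡ c u
      c≡ rewrite eqv = refl
    ... | no ¬p | no ¬q = outside m≡ c≡ (^-monoʳ-≤ 2 (size-outside x c≡ ¬p))
      where
      m≡ : merged x ≡ 0
      m≡ rewrite equ | eqv = refl
      c≡ : c′ x ≡ c x
      c≡ rewrite eqv = refl

    weight-merge : ∀ x → weight c′ x ≤ weight c x + mergedWeight * merged x
    weight-merge x with cases x
    ... | outside _ _ w≤   = ≤-trans w≤ (m≤m+n _ _)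
    ... | inside  m≡ _ w≤ rewrite m≡ = ≤-trans w≤ (≤-trans (≤-reflexive (sym (*-identityʳ _))) (m≤n+m _ _))

    totalWeight-merge : totalWeight c′ ≤ totalWeight c + mergedWeight * mergedSize
    totalWeight-merge = begin
      totalWeight c′                              ≤⟨ sum-mono-≤ weight-merge ⟩
      ∑[ x < n ] (weight c x + mergedWeight * merged x)
        ≡⟨ sum-linear (weight c) merged mergedWeight ⟩
      totalWeight c + mergedWeight * sum merged   ≡⟨ cong (λ k → totalWeight c + mergedWeight * k) ∑merged ⟩
      totalWeight c + mergedWeight * mergedSize   ∎
      where open ≤-Reasoning

    -- Counted in units of `mergedWeight`: an end in the new class is charged the old weight of the
    -- other end. Being a sum of products, this factors when summed over all pairs.
    increase : Fin n × Fin n → ℕ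
    increase (x , y) = merged x * weight c y + merged y * weight c x

    ∑increase : ∑[ e < M n ] increase (ends n e) ≤ 2 * (mergedSize * totalWeight c)
    ∑increase = begin
      ∑[ e < M n ] increase (ends n e)                  ≤⟨ sum-ends n increase ⟩
      ∑[ x < n ] ∑[ y < n ] increase (x , y)
        ≡⟨ sum-cong-≗ (λ x → ∑-distrib-+ (λ y → merged x * weight c y) (λ y → merged y * weight c x)) ⟩
      ∑[ x < n ] (∑[ y < n ] (merged x * weight c y) + ∑[ y < n ] (merged y * weight c x))
        ≡⟨ sum-cong-≗ (λ x → cong₂ _+_ (sym (*-distribˡ-sum (merged x) (weight c)))
                                       (sym (*-distribʳ-sum (weight c x) merged))) ⟩
      ∑[ x < n ] (merged x * totalWeight c + sum merged * weight c x)
        ≡⟨ sum-linear (λ x → merged x * totalWeight c) (weight c) (sum merged) ⟩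
      ∑[ x < n ] (merged x * totalWeight c) + sum merged * totalWeight c
        ≡⟨ cong (_+ sum merged * totalWeight c) (sym (*-distribʳ-sum (totalWeight c) merged)) ⟩
      sum merged * totalWeight c + sum merged * totalWeight c
        ≡⟨ cong₂ _+_ (cong (_* totalWeight c) ∑merged) (cong (_* totalWeight c) ∑merged) ⟩
      mergedSize * totalWeight c + mergedSize * totalWeight c
        ≡⟨ cong (mergedSize * totalWeight c +_) (sym (+-identityʳ _)) ⟩
      2 * (mergedSize * totalWeight c) ∎
      where open ≤-Reasoning

    -- A pair with both ends in the new class drops to 0, and one with both ends outside does not
    -- grow. With one end inside, the new product is at most `mergedWeight` times the weight of the
    -- other end.
    crossWeight-merge : ∀ p → crossWeight c′ p ≤ crossWeight c p + mergedWeight * increase p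
    crossWeight-merge (x , y) with c′ x ≟ c′ y
    ... | yes _ = z≤n
    ... | no c′x≢c′y with cases x | cases y
    ...   | inside _ cx _ | inside _ cy _ = contradiction (trans cx (sym cy)) c′x≢c′y
    ...   | outside _ cx wx | outside _ cy wy with c x ≟ c y
    ...     | yes eq = contradiction (trans cx (trans eq (sym cy))) c′x≢c′y
    ...     | no _   = ≤-trans (*-mono-≤ wx wy) (m≤m+n _ _)
    crossWeight-merge (x , y) | no _ | inside mx _ wx | outside my _ wy
      rewrite mx | my = ≤-trans (*-mono-≤ wx wy)
        (≤-trans (≤-reflexive (lemma mergedWeight (weight c y))) (m≤n+m _ _))
      where
      lemma : ∀ p a → p * a ≡ p * (a + 0 + 0)
      lemma = solve-∀
    crossWeight-merge (x , y) | no _ | outside mx _ wx | inside my _ wy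
      rewrite mx | my = ≤-trans (*-mono-≤ wx wy)
        (≤-trans (≤-reflexive (lemma mergedWeight (weight c x))) (m≤n+m _ _))
      where
      lemma : ∀ p a → a * p ≡ p * (0 + (a + 0))
      lemma = solve-∀

χ-disjoint : ∀ {m} {p q r : Subset m} → p ⊆ r → q ⊆ r → (∀ {i} → i ∈ p → i ∉ q) →
  ∀ i → χ p i + χ q i ≤ χ r i
χ-disjoint {p = p} {q} {r} p⊆r q⊆r disj i
  with Vec.lookup p i in eqp | Vec.lookup q i in eqq | Vec.lookup r i in eqr
... | true  | true  | _     = contradiction (lookup⇒[]= i q eqq) (disj (lookup⇒[]= i p eqp))
... | true  | false | true  = ≤-refl
... | true  | false | false = contradiction (trans (sym eqr) ([]=⇒lookup (p⊆r (lookup⇒[]= i p eqp)))) λ ()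
... | false | true  | true  = ≤-refl
... | false | true  | false = contradiction (trans (sym eqr) ([]=⇒lookup (q⊆r (lookup⇒[]= i q eqq)))) λ ()
... | false | false | _     = z≤n

module _ {n : ℕ} (c : Fin n → Fin n) (u v : Fin n) (cu≢cv : c u ≢ c v) where
  open Merge c u v cu≢cv

  -- Charging edge by edge. An edge that stays free pays for its `increase`. An edge claimed by
  -- Enforcer is measured in the old labelling: between classes its own old term is at least
  -- `mergedWeight`, and inside a class the deficit is charged to `inner`.
  crossPotential-merge : ∀ (F F′ S : EdgeSet n) →
    (∀ e → χ F′ e + χ S e ≤ χ F e) →
    (∀ e → e ∈ F → c (proj₁ (ends n e)) ≢ c (proj₂ (ends n e)) → mergedWeight ≤ crossWeight c (ends n e)) →
    crossPotential c′ F′ + mergedWeight * ∣ S ∣ ≤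
    crossPotential c F + mergedWeight * (totalWeight c + 2 * (mergedSize * totalWeight c))
  crossPotential-merge F F′ S split least = begin
    crossPotential c′ F′ + mergedWeight * ∣ S ∣
      ≡⟨ cong (λ k → crossPotential c′ F′ + mergedWeight * k) (∣p∣≡∑χ S) ⟩
    crossPotential c′ F′ + mergedWeight * sum (χ S)
      ≡⟨ sum-linear _ (χ S) mergedWeight ⟨
    ∑[ e < M n ] (χ F′ e * crossWeight c′ (ends n e) + mergedWeight * χ S e)
      ≤⟨ sum-mono-≤ pointwise ⟩
    ∑[ e < M n ] (χ F e * crossWeight c (ends n e) + mergedWeight * (inner e + increase (ends n e)))
      ≡⟨ sum-linear _ (λ e → inner e + increase (ends n e)) mergedWeight ⟩
    crossPotential c F + mergedWeight * (∑[ e < M n ] (inner e + increase (ends n e)))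
      ≡⟨ cong (λ k → crossPotential c F + mergedWeight * k) (∑-distrib-+ inner _) ⟩
    crossPotential c F + mergedWeight * (sum inner + ∑[ e < M n ] increase (ends n e))
      ≤⟨ +-monoʳ-≤ (crossPotential c F) (*-monoʳ-≤ mergedWeight (+-mono-≤ (innerPairs≤totalWeight c) ∑increase)) ⟩
    crossPotential c F + mergedWeight * (totalWeight c + 2 * (mergedSize * totalWeight c)) ∎
    where
    open ≤-Reasoning
    inner : Edge n → ℕ
    inner e = ⟦ c (proj₁ (ends n e)) ≟ c (proj₂ (ends n e)) ⟧

    claimed : ∀ e → e ∈ F →
      mergedWeight ≤ crossWeight c (ends n e) + mergedWeight * (inner e + increase (ends n e))
    claimed e e∈F with c (proj₁ (ends n e)) ≟ c (proj₂ (ends n e)) | least e e∈F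
    -- Here `inner e` is 1, so the second factor is positive.
    ... | yes _ | _ = m≤m*n mergedWeight _
    ... | no ¬p | h = ≤-trans (h ¬p) (m≤m+n _ _)

    pointwise : ∀ e → χ F′ e * crossWeight c′ (ends n e) + mergedWeight * χ S e ≤
      χ F e * crossWeight c (ends n e) + mergedWeight * (inner e + increase (ends n e))
    pointwise e with Vec.lookup F′ e | Vec.lookup S e | Vec.lookup F e in eqF | split e
    ... | true  | true  | true  | s≤s ()
    ... | true  | true  | false | ()
    ... | true  | false | false | ()
    ... | false | true  | false | ()
    ... | true  | false | true  | _ = begin
      crossWeight c′ (ends n e) + 0 + mergedWeight * 0
        ≡⟨ lemma (crossWeight c′ (ends n e)) mergedWeight ⟩
      crossWeight c′ (ends n e)
        ≤⟨ crossWeight-merge (ends n e) ⟩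
      crossWeight c (ends n e) + mergedWeight * increase (ends n e)
        ≤⟨ +-mono-≤ (m≤m+n (crossWeight c (ends n e)) 0) (*-monoʳ-≤ mergedWeight (m≤n+m _ (inner e))) ⟩
      crossWeight c (ends n e) + 0 + mergedWeight * (inner e + increase (ends n e)) ∎
      where
      lemma : ∀ a p → a + 0 + p * 0 ≡ a
      lemma = solve-∀
    ... | false | true  | true  | _ = begin
      mergedWeight * 1  ≡⟨ *-identityʳ mergedWeight ⟩
      mergedWeight      ≤⟨ claimed e (lookup⇒[]= e F eqF) ⟩
      crossWeight c (ends n e) + mergedWeight * (inner e + increase (ends n e))
        ≤⟨ +-monoˡ-≤ _ (m≤m+n (crossWeight c (ends n e)) 0) ⟩
      crossWeight c (ends n e) + 0 + mergedWeight * (inner e + increase (ends n e)) ∎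
    ... | false | false | _ | _ = ≤-trans (≤-reflexive (*-zeroʳ mergedWeight)) z≤n

-- Truncated exponential series and the logarithmic bound from the bias.

-- halfExp a K = K! 2^K Σ_{k≤K} (a/2)^k / k!, so the argument of the exponential advances by ½.
halfExp : ℕ → ℕ → ℕ
halfExp a zero    = 1
halfExp a (suc K) = 2 * suc K * halfExp a K + a ^ suc K

-- A discrete mean value bound: the derivative of x^(k+1) on [a, a+1] is largest at a+1.
suc-^-≤ : ∀ a k → suc a ^ suc k ≤ a ^ suc k + suc k * suc a ^ k
suc-^-≤ a zero    = ≤-reflexive (lemma a)
  where
  lemma : ∀ a → (1 + a) * 1 ≡ a * 1 + 1
  lemma = solve-∀
suc-^-≤ a (suc k) = begin
  suc a * suc a ^ suc k
    ≡⟨⟩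
  suc a ^ suc k + a * suc a ^ suc k
    ≤⟨ +-monoʳ-≤ (suc a ^ suc k) (*-monoʳ-≤ a (suc-^-≤ a k)) ⟩
  suc a ^ suc k + a * (a ^ suc k + suc k * suc a ^ k)
    ≡⟨ lemma (suc a ^ suc k) a (a ^ suc k) (suc k) (suc a ^ k) ⟩
  a * a ^ suc k + (suc a ^ suc k + suc k * (a * suc a ^ k))
    ≤⟨ +-monoʳ-≤ (a * a ^ suc k) (+-monoʳ-≤ (suc a ^ suc k) (*-monoʳ-≤ (suc k) (m≤n+m _ (suc a ^ k)))) ⟩
  a ^ suc (suc k) + suc (suc k) * suc a ^ suc k ∎
  where
  open ≤-Reasoning
  lemma : ∀ p a x k y → p + a * (x + k * y) ≡ a * x + (p + k * (a * y))
  lemma = solve-∀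

-- e^((a+1)/2) ≤ e^(a/2) + ½ e^((a+1)/2) for the truncated series, which bounds the ratio by 2.
halfExp-suc-aux : ∀ a K → halfExp (suc a) (suc K) ≤ halfExp a (suc K) + suc K * halfExp (suc a) K
halfExp-suc-aux a zero    = ≤-reflexive (lemma a)
  where
  lemma : ∀ a → 2 + (1 + a) * 1 ≡ 2 + a * 1 + 1
  lemma = solve-∀
halfExp-suc-aux a (suc K) = begin
  2 * suc (suc K) * halfExp (suc a) (suc K) + suc a ^ suc (suc K)
    ≤⟨ +-mono-≤ (*-monoʳ-≤ (2 * suc (suc K)) (halfExp-suc-aux a K)) (suc-^-≤ a (suc K)) ⟩
  2 * suc (suc K) * (halfExp a (suc K) + suc K * halfExp (suc a) K) + (a ^ suc (suc K) + suc (suc K) * suc a ^ suc K)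
    ≡⟨ lemma (suc (suc K)) (suc K) (halfExp a (suc K)) (halfExp (suc a) K) (a ^ suc (suc K)) (suc a ^ suc K) ⟩
  halfExp a (suc (suc K)) + suc (suc K) * halfExp (suc a) (suc K) ∎
  where
  open ≤-Reasoning
  lemma : ∀ l k x y p q → 2 * l * (x + k * y) + (p + l * q) ≡ (2 * l * x + p) + l * (2 * k * y + q)
  lemma = solve-∀

halfExp-suc : ∀ a K → halfExp (suc a) K ≤ 2 * halfExp a K
halfExp-suc a zero    = s≤s z≤n
halfExp-suc a (suc K) = +-cancelʳ-≤ (halfExp (suc a) (suc K)) _ _ (begin
  halfExp (suc a) (suc K) + halfExp (suc a) (suc K)
    ≡⟨ cong (halfExp (suc a) (suc K) +_) (sym (+-identityʳ _)) ⟩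
  2 * halfExp (suc a) (suc K)
    ≤⟨ *-monoʳ-≤ 2 (halfExp-suc-aux a K) ⟩
  2 * (halfExp a (suc K) + suc K * halfExp (suc a) K)
    ≡⟨ lemma (halfExp a (suc K)) (suc K) (halfExp (suc a) K) ⟩
  -- The last summand is the recursive part of `halfExp (suc a) (suc K)`, so one of the two copies
  -- on the left cancels.
  2 * halfExp a (suc K) + 2 * suc K * halfExp (suc a) K
    ≤⟨ +-monoʳ-≤ (2 * halfExp a (suc K)) (m≤m+n _ _) ⟩
  2 * halfExp a (suc K) + halfExp (suc a) (suc K) ∎)
  where
  open ≤-Reasoning
  lemma : ∀ x k y → 2 * (x + k * y) ≡ 2 * x + 2 * k * y
  lemma = solve-∀

halfExp-zero : ∀ K → halfExp 0 K ≡ 2 ^ K * K !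
halfExp-zero zero    = refl
halfExp-zero (suc K) rewrite halfExp-zero K = lemma (suc K) (2 ^ K) (K !)
  where
  lemma : ∀ k p q → 2 * k * (p * q) + 0 ≡ 2 * p * (k * q)
  lemma = solve-∀

halfExp-≤ : ∀ a K → halfExp a K ≤ 2 ^ a * (2 ^ K * K !)
halfExp-≤ zero    K = ≤-reflexive (trans (halfExp-zero K) (sym (+-identityʳ _)))
halfExp-≤ (suc a) K = ≤-trans (halfExp-suc a K)
  (≤-trans (*-monoʳ-≤ 2 (halfExp-≤ a K)) (≤-reflexive (sym (*-assoc 2 (2 ^ a) _))))

^-distribʳ-* : ∀ m n k → (m * n) ^ k ≡ m ^ k * n ^ k
^-distribʳ-* m n zero    = refl
^-distribʳ-* m n (suc k) = trans (cong (m * n *_) (^-distribʳ-* m n k)) (lemma m n (m ^ k) (n ^ k))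
  where
  lemma : ∀ a b x y → a * b * (x * y) ≡ a * x * (b * y)
  lemma = solve-∀

halfExp-double : ∀ b K → halfExp (2 * b) K ≡ 2 ^ K * expT b K
halfExp-double b zero    = refl
halfExp-double b (suc K) rewrite halfExp-double b K | ^-distribʳ-* 2 b (suc K) =
  lemma (suc K) (2 ^ K) (expT b K) (b ^ suc K)
  where
  lemma : ∀ k p x y → 2 * k * (p * x) + 2 * p * y ≡ 2 * p * (k * x + y)
  lemma = solve-∀

-- The truncated form of e^b ≤ 4^b: going from 0 to b takes 2b half steps, each of which at most
-- doubles the series.
expT-≤ : ∀ b K → expT b K ≤ 2 ^ (2 * b) * K !
expT-≤ b K = *-cancelˡ-≤ (2 ^ K) {{m^n≢0 2 K}} (begin
  2 ^ K * expT b K               ≡⟨ halfExp-double b K ⟨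
  halfExp (2 * b) K              ≤⟨ halfExp-≤ (2 * b) K ⟩
  2 ^ (2 * b) * (2 ^ K * K !)    ≡⟨ lemma (2 ^ (2 * b)) (2 ^ K) (K !) ⟩
  2 ^ K * (2 ^ (2 * b) * K !)    ∎)
  where
  open ≤-Reasoning
  lemma : ∀ x y z → x * (y * z) ≡ y * (x * z)
  lemma = solve-∀

2^-cancel-≤ : ∀ {i j} → 2 ^ i ≤ 2 ^ j → i ≤ j
2^-cancel-≤ {i} {j} h with ≤-<-connex i j
... | inj₁ i≤j = i≤j
... | inj₂ j<i = contradiction h (<⇒≱ (^-monoʳ-< 2 (s≤s (s≤s z≤n)) j<i))

-- The bias hypothesis without logarithms: 2^(200nk) ≤ n^(600n) ≤ 4^(3b), then exponents are
-- compared.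
bias-log : ∀ {n b} → BiasAtLeast200nlnn n b → ∀ k → 2 ^ k ≤ n ^ 3 → k * (100 * n) ≤ 3 * b
bias-log {n} {b} (K , h) k 2^k≤n³ = *-cancelˡ-≤ 2 (2^-cancel-≤ (begin
  2 ^ (2 * (k * (100 * n)))  ≡⟨ cong (2 ^_) (lemma₁ k n) ⟩
  2 ^ (k * (200 * n))        ≡⟨ ^-*-assoc 2 k (200 * n) ⟨
  (2 ^ k) ^ (200 * n)        ≤⟨ ^-monoˡ-≤ (200 * n) 2^k≤n³ ⟩
  (n ^ 3) ^ (200 * n)        ≡⟨ ^-*-assoc n 3 (200 * n) ⟩
  n ^ (3 * (200 * n))        ≡⟨ cong (n ^_) (*-comm 3 (200 * n)) ⟩
  n ^ (200 * n * 3)          ≡⟨ ^-*-assoc n (200 * n) 3 ⟨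
  (n ^ (200 * n)) ^ 3        ≤⟨ ^-monoˡ-≤ 3 n^≤4^b ⟩
  (2 ^ (2 * b)) ^ 3          ≡⟨ ^-*-assoc 2 (2 * b) 3 ⟩
  2 ^ (2 * b * 3)            ≡⟨ cong (2 ^_) (lemma₂ b) ⟩
  2 ^ (2 * (3 * b))          ∎))
  where
  open ≤-Reasoning
  lemma₁ : ∀ k n → 2 * (k * (100 * n)) ≡ k * (200 * n)
  lemma₁ = solve-∀
  lemma₂ : ∀ b → 2 * b * 3 ≡ 2 * (3 * b)
  lemma₂ = solve-∀
  n^≤4^b : n ^ (200 * n) ≤ 2 ^ (2 * b)
  n^≤4^b = *-cancelʳ-≤ _ _ (K !) {{K !≢0}} (≤-trans h (expT-≤ b K))

-- Adding an edge between two classes creates no cycle.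

module _ {V : Set} where

  -- `HasCycle n F` is by definition `Cycle (Adj n F)`.
  Cycle : (V → V → Set) → Set
  Cycle Q = ∃[ x ] ∃[ xs ] (2 ≤ length xs × Unique (x ∷ xs) × Linked Q (x ∷ xs ++ x ∷ []))

  last : V → List V → V
  last x []       = x
  last x (y ∷ ys) = last y ys

  last-∈ : ∀ y ys → last y ys ∈ˡ y ∷ ys
  last-∈ y []       = here refl
  last-∈ y (z ∷ zs) = there (last-∈ z zs)

  linked-∷ʳ⁻ : ∀ {Q : V → V → Set} x xs {z} → Linked Q (x ∷ xs ++ z ∷ []) → Linked Q (x ∷ xs) × Q (last x xs) z
  linked-∷ʳ⁻ x []       (q ∷ [-]) = [-] , q
  linked-∷ʳ⁻ x (y ∷ ys) (q ∷ l)   = let (l′ , r) = linked-∷ʳ⁻ y ys l in q ∷ l′ , r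

  linked-∷ʳ⁺ : ∀ {Q : V → V → Set} x xs {z} → Linked Q (x ∷ xs) → Q (last x xs) z → Linked Q (x ∷ xs ++ z ∷ [])
  linked-∷ʳ⁺ x []       _       r = r ∷ [-]
  linked-∷ʳ⁺ x (y ∷ ys) (q ∷ l) r = q ∷ linked-∷ʳ⁺ y ys l r

module _ {V C : Set} (R R′ : V → V → Set) (c : V → C) (u v : V) (cu≢cv : c u ≢ c v)
  (R-mono : ∀ {x y} → R x y → c x ≡ c y)
  where

  Bridge : V → V → Set
  Bridge x y = (x ≡ u × y ≡ v) ⊎ (x ≡ v × y ≡ u)

  path-mono : ∀ x xs → Linked R (x ∷ xs) → c x ≡ c (last x xs)
  path-mono x []       _       = refl
  path-mono x (y ∷ ys) (r ∷ l) = trans (R-mono r) (path-mono y ys l)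

  bridge-≢ : ∀ {x y} → Bridge x y → c x ≢ c y
  bridge-≢ (inj₁ (refl , refl)) = cu≢cv
  bridge-≢ (inj₂ (refl , refl)) = cu≢cv ∘ sym

  bridge-unique : ∀ {x y p q} → Bridge x y → Bridge p q → (p ≡ x × q ≡ y) ⊎ (p ≡ y × q ≡ x)
  bridge-unique (inj₁ (refl , refl)) b = b
  bridge-unique (inj₂ (refl , refl)) (inj₁ b) = inj₂ b
  bridge-unique (inj₂ (refl , refl)) (inj₂ b) = inj₁ b

  module _ (step : ∀ {x y} → R′ x y → R x y ⊎ Bridge x y) where

    -- A step over the bridge would visit both of its ends.
    avoids-bridge : ∀ {p q} xs → Bridge p q → All (p ≢_) xs → Linked R′ xs → Linked R xs
    avoids-bridge []           b _ _ = []
    avoids-bridge (x ∷ [])     b _ _ = [-]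
    avoids-bridge (x ∷ y ∷ ys) b (p≢x ∷ p≢y ∷ ps) (r ∷ l) with step r
    ... | inj₁ r₀ = r₀ ∷ avoids-bridge (y ∷ ys) b (p≢y ∷ ps) l
    ... | inj₂ b′ with bridge-unique b′ b
    ...   | inj₁ (p≡x , _) = contradiction p≡x p≢x
    ...   | inj₂ (p≡y , _) = contradiction p≡y p≢y

    -- The last clause serves the case where the cycle also closes over the bridge: the path would
    -- then be that one edge, too short for a cycle. The membership of `p` makes the clause vacuous
    -- once another vertex is prepended.
    Crosses : V → List V → Set
    Crosses x xs = ∃[ p ] ∃[ q ] (Bridge p q × c x ≡ c p × c (last x xs) ≡ c q × p ∈ˡ x ∷ xs ×
      (x ≡ p → last x xs ≡ q → length xs ≡ 1))

    -- A path without repeated vertices crosses the bridge at most once, because its tail never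
    -- returns to the end where it crossed.
    path-split : ∀ x xs → Linked R′ (x ∷ xs) → Unique (x ∷ xs) → Linked R (x ∷ xs) ⊎ Crosses x xs
    path-split x []       _       _ = inj₁ [-]
    path-split x (y ∷ ys) (r ∷ l) (x∉ ∷ uniq) with step r
    ... | inj₂ b = inj₂ (x , y , b , refl , sym (path-mono y ys l₀) , here refl , λ _ → short ys uniq)
      where
      l₀ : Linked R (y ∷ ys)
      l₀ = avoids-bridge (y ∷ ys) b x∉ l
      short : ∀ zs → Unique (y ∷ zs) → last y zs ≡ y → suc (length zs) ≡ 1
      short []       _         _  = refl
      short (z ∷ zs) (y∉ ∷ _) eq = contradiction (sym eq) (All.lookup y∉ (last-∈ z zs))
    ... | inj₁ r₀ with path-split y ys l uniq
    ...   | inj₁ l₀ = inj₁ (r₀ ∷ l₀)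
    ...   | inj₂ (p , q , b , cy≡ , cl≡ , p∈ , _) =
      inj₂ (p , q , b , trans (R-mono r₀) cy≡ , cl≡ , there p∈ , λ x≡p → contradiction x≡p (All.lookup x∉ p∈))

    -- The cycle is cut into a path and its closing step. If neither uses the bridge, the cycle is
    -- old; if exactly one does, labels would agree across the bridge. If both do, they either cross
    -- in the same direction, which the labels forbid, or the path has length 1.
    bridge-acyclic : Cycle R′ → Cycle R
    bridge-acyclic (x , xs , 2≤ , uniq , l) with linked-∷ʳ⁻ x xs l
    ... | (l′ , r) with path-split x xs l′ uniq | step r
    ...   | inj₁ l₀ | inj₁ r₀ = x , xs , 2≤ , uniq , linked-∷ʳ⁺ x xs l₀ r₀
    ...   | inj₁ l₀ | inj₂ b  = contradiction (sym (path-mono x xs l₀)) (bridge-≢ b)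
    ...   | inj₂ (p , q , b , cx≡ , cl≡ , _) | inj₁ r₀ =
      contradiction (trans (sym cx≡) (trans (sym (R-mono r₀)) cl≡)) (bridge-≢ b)
    ...   | inj₂ (p , q , b , cx≡ , cl≡ , _ , short) | inj₂ b′ with bridge-unique b b′
    ...     | inj₁ (_ , x≡q) = contradiction (trans (sym cx≡) (cong c x≡q)) (bridge-≢ b)
    ...     | inj₂ (l≡q , x≡p) with xs | 2≤ | short x≡p l≡q
    ...       | _ ∷ [] | s≤s () | _

-- Positions and legal moves.

∣p∪q∣≤∣p∣+∣q∣ : ∀ {m} (p q : Subset m) → ∣ p ∪ q ∣ ≤ ∣ p ∣ + ∣ q ∣
∣p∪q∣≤∣p∣+∣q∣ Vec.[] Vec.[] = z≤n
∣p∪q∣≤∣p∣+∣q∣ (true  Vec.∷ p) (true  Vec.∷ q) =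
  s≤s (≤-trans (∣p∪q∣≤∣p∣+∣q∣ p q) (+-monoʳ-≤ ∣ p ∣ (n≤1+n _)))
∣p∪q∣≤∣p∣+∣q∣ (true  Vec.∷ p) (false Vec.∷ q) = s≤s (∣p∪q∣≤∣p∣+∣q∣ p q)
∣p∪q∣≤∣p∣+∣q∣ (false Vec.∷ p) (true  Vec.∷ q) =
  ≤-trans (s≤s (∣p∪q∣≤∣p∣+∣q∣ p q)) (≤-reflexive (sym (+-suc ∣ p ∣ ∣ q ∣)))
∣p∪q∣≤∣p∣+∣q∣ (false Vec.∷ p) (false Vec.∷ q) = ∣p∪q∣≤∣p∣+∣q∣ p q

module _ (n : ℕ) where

  ∈Free⁻ : ∀ {A E : EdgeSet n} {e} → e ∈ Free n A E → e ∉ A × e ∉ E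
  ∈Free⁻ {A} {E} e∈ = (λ e∈A → x∈∁p⇒x∉p e∈ (p⊆p∪q E e∈A)) , (λ e∈E → x∈∁p⇒x∉p e∈ (q⊆p∪q A E e∈E))

  ∈Free⁺ : ∀ {A E : EdgeSet n} {e} → e ∉ A → e ∉ E → e ∈ Free n A E
  ∈Free⁺ {A} {E} e∉A e∉E = x∉p⇒x∈∁p ([ e∉A , e∉E ]′ ∘ x∈p∪q⁻ A E)

  Free-antitone : ∀ {A A′ E E′ : EdgeSet n} → A ⊆ A′ → E ⊆ E′ → Free n A′ E′ ⊆ Free n A E
  Free-antitone A⊆ E⊆ e∈ = let (e∉A , e∉E) = ∈Free⁻ e∈ in ∈Free⁺ (e∉A ∘ A⊆) (e∉E ∘ E⊆)

  claim-all : ∀ {A E S : EdgeSet n} → Free n A E ⊆ S → Empty (Free n A (E ∪ S))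
  claim-all {A} {E} {S} F⊆S (e , e∈) = let (e∉A , e∉ES) = ∈Free⁻ e∈ in
    e∉ES (q⊆p∪q E S (F⊆S (∈Free⁺ e∉A (e∉ES ∘ p⊆p∪q S))))

  -- Enforcer's edges and the edges still free are disjoint parts of the old free set.
  χ-Free : ∀ (A A′ E S : EdgeSet n) → A ⊆ A′ → S ⊆ Free n A′ E →
    ∀ e → χ (Free n A′ (E ∪ S)) e + χ S e ≤ χ (Free n A E) e
  χ-Free A A′ E S A⊆A′ S⊆ = χ-disjoint
    (Free-antitone A⊆A′ (p⊆p∪q S))
    (Free-antitone A⊆A′ id ∘ S⊆)
    (λ e∈ e∈S → proj₂ (∈Free⁻ {A′} {E ∪ S} e∈) (q⊆p∪q E S e∈S))

  -- Lets one strategy serve both variants.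
  singleton-legal : ∀ v {A E : EdgeSet n} {e} → e ∈ Free n A E → AvLegal n v A E ⁅ e ⁆
  singleton-legal v {e = e} e∈ = go v
    where
    ⊆F = λ {x} x∈ → subst (_∈ _) (sym (x∈⁅y⁆⇒x≡y {x = x} e x∈)) e∈
    go : ∀ v → AvLegal n v _ _ ⁅ e ⁆
    go strict   = ⊆F , ∣⁅x⁆∣≡1 e
    go monotone = ⊆F , ≤-reflexive (sym (∣⁅x⁆∣≡1 e))

  enforcer-claims : ∀ v {b} {A E S : EdgeSet n} → EnfLegal n v b A E S →
    S ⊆ Free n A E × (Free n A E ⊆ S ⊎ (b ≤ ∣ Free n A E ∣ × b ≤ ∣ S ∣))
  enforcer-claims v        (S⊆ , inj₁ (_ , S≡)) = S⊆ , inj₁ (⊆-reflexive (sym S≡))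
  enforcer-claims strict   (S⊆ , inj₂ (b≤F , S≡)) = S⊆ , inj₂ (b≤F , ≤-reflexive (sym S≡))
  enforcer-claims monotone (S⊆ , inj₂ (b≤F , b≤S)) = S⊆ , inj₂ (b≤F , b≤S)

  -- The second alternative has the shape of `Bridge`, as `bridge-acyclic` expects.
  Adj-∪-⁅⁆ : ∀ (A : EdgeSet n) e {x y} → Adj n (A ∪ ⁅ e ⁆) x y →
    Adj n A x y ⊎ ((x ≡ proj₁ (ends n e) × y ≡ proj₂ (ends n e)) ⊎ (x ≡ proj₂ (ends n e) × y ≡ proj₁ (ends n e)))
  Adj-∪-⁅⁆ A e (f , f∈ , ends≡) with x∈p∪q⁻ A ⁅ e ⁆ f∈
  ... | inj₁ f∈A = inj₁ (f , f∈A , ends≡)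
  ... | inj₂ f∈e with x∈⁅y⁆⇒x≡y e f∈e | ends≡
  ...   | refl | inj₁ eq = inj₂ (inj₁ (sym (cong proj₁ eq) , sym (cong proj₂ eq)))
  ...   | refl | inj₂ eq = inj₂ (inj₂ (sym (cong proj₂ eq) , sym (cong proj₁ eq)))

  forest⇒forestPlusOne : ∀ {A} → Forest n A → ForestPlusOne n A
  forest⇒forestPlusOne {A} forest = A , id , forest , m≤m+n _ 1

-- Avoider's strategy and its invariant.

module Strategy {n b : ℕ} (variant : Variant) .{{_ : NonZero n}} (3n<b : 3 * n < b)
  (cheap : ∀ k → 2 ^ k ≤ 12 * (n * n) → 3 * n + 10 * (n * k) ≤ b)
  where

  -- The factor 4n makes the bound 12n² on the potential yield `totalWeight` at most 3n.
  potential : (Fin n → Fin n) → EdgeSet n → ℕ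
  potential c F = crossPotential c F + 4 * n * totalWeight c

  record Safe (A E : EdgeSet n) (c : Fin n → Fin n) : Set where
    field
      inner    : ∀ {x y} → Adj n A x y → c x ≡ c y
      forest   : Forest n A
      potential≤ : potential c (Free n A E) ≤ 12 * (n * n)

    totalWeight≤ : totalWeight c ≤ 3 * n
    totalWeight≤ = *-cancelˡ-≤ (4 * n) {{m*n≢0 4 n}} (begin
      4 * n * totalWeight c    ≤⟨ m≤n+m _ (crossPotential c (Free n A E)) ⟩
      potential c (Free n A E) ≤⟨ potential≤ ⟩
      12 * (n * n)             ≡⟨ lemma n ⟩
      4 * n * (3 * n)          ∎)
      where
      open ≤-Reasoning
      lemma : ∀ n → 12 * (n * n) ≡ 4 * n * (3 * n)
      lemma = solve-∀

  module _ {A E : EdgeSet n} {c : Fin n → Fin n} (safe : Safe A E c) where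
    open Safe safe

    inner-free<b : (∀ e → ¬ (e ∈ Free n A E × c (proj₁ (ends n e)) ≢ c (proj₂ (ends n e)))) →
      ∣ Free n A E ∣ < b
    inner-free<b none = ≤-<-trans (begin
      ∣ Free n A E ∣      ≡⟨ ∣p∣≡∑χ (Free n A E) ⟩
      sum (χ (Free n A E)) ≤⟨ sum-mono-≤ pointwise ⟩
      ∑[ e < M n ] ⟦ c (proj₁ (ends n e)) ≟ c (proj₂ (ends n e)) ⟧
                          ≤⟨ innerPairs≤totalWeight c ⟩
      totalWeight c       ≤⟨ totalWeight≤ ⟩
      3 * n               ∎) 3n<b
      where
      open ≤-Reasoning
      pointwise : ∀ e → χ (Free n A E) e ≤ ⟦ c (proj₁ (ends n e)) ≟ c (proj₂ (ends n e)) ⟧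
      pointwise e with Vec.lookup (Free n A E) e in eq | c (proj₁ (ends n e)) ≟ c (proj₂ (ends n e))
      ... | false | _     = z≤n
      ... | true  | yes _ = ≤-refl
      ... | true  | no ≢  = contradiction (lookup⇒[]= e _ eq , ≢) (none e)

    -- Enforcer must now take everything that remains, so `A` is a forest missing at most the one
    -- edge `e`.
    last-round : ∀ {e} → e ∈ Free n A E → ∣ Free n A E ∣ < b →
      AvoiderForces n variant b (ForestPlusOne n) A E avoider
    last-round {e} e∈ F<b = avMove (e , e∈) ⁅ e ⁆ (singleton-legal n variant {A} {E} e∈) respond
      where
      A′ : EdgeSet n
      A′ = A ∪ ⁅ e ⁆

      goal : ForestPlusOne n A′
      goal = A , p⊆p∪q ⁅ e ⁆ , forest ,
        ≤-trans (∣p∪q∣≤∣p∣+∣q∣ A ⁅ e ⁆) (≤-reflexive (cong (∣ A ∣ +_) (∣⁅x⁆∣≡1 e)))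

      F′<b : ∣ Free n A′ E ∣ < b
      F′<b = ≤-<-trans (p⊆q⇒∣p∣≤∣q∣ {p = Free n A′ E} {q = Free n A E} (Free-antitone n {E = E} (p⊆p∪q {p = A} ⁅ e ⁆) id)) F<b

      respond : AvoiderForces n variant b (ForestPlusOne n) A′ E enforcer
      respond with nonempty? (Free n A′ E)
      ... | no  none = finished none goal
      ... | yes some = enfMove some λ S legal → continue S (enforcer-claims n variant legal)
        where
        continue : ∀ S → S ⊆ Free n A′ E × (Free n A′ E ⊆ S ⊎ (b ≤ ∣ Free n A′ E ∣ × b ≤ ∣ S ∣)) →
          AvoiderForces n variant b (ForestPlusOne n) A′ (E ∪ S) avoider
        continue S (_ , inj₁ F⊆S)       = finished (claim-all n {A = A′} F⊆S) goal
        continue S (_ , inj₂ (b≤F , _)) = contradiction b≤F (<⇒≱ F′<b)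

    module Joining (e : Edge n) (e∈ : e ∈ Free n A E)
      (cross : c (proj₁ (ends n e)) ≢ c (proj₂ (ends n e)))
      (least : ∀ f → f ∈ Free n A E × c (proj₁ (ends n f)) ≢ c (proj₂ (ends n f)) →
               crossWeight c (ends n e) ≤ crossWeight c (ends n f))
      where

      u v : Fin n
      u = proj₁ (ends n e)
      v = proj₂ (ends n e)

      open Merge c u v cross

      A′ : EdgeSet n
      A′ = A ∪ ⁅ e ⁆

      inner′ : ∀ {x y} → Adj n A′ x y → c′ x ≡ c′ y
      inner′ adj with Adj-∪-⁅⁆ n A e adj
      ... | inj₁ adjA = cong (λ z → if does (z ≟ c v) then c u else z) (inner adjA)
      ... | inj₂ b = bridge b
        where
        ends-merged : c′ u ≡ c′ v
        ends-merged with c u ≟ c v | c v ≟ c v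
        ... | yes p | _     = contradiction p cross
        ... | no _  | yes _ = refl
        ... | no _  | no ¬q = contradiction refl ¬q
        bridge : ∀ {x y} → (x ≡ u × y ≡ v) ⊎ (x ≡ v × y ≡ u) → c′ x ≡ c′ y
        bridge (inj₁ (refl , refl)) = ends-merged
        bridge (inj₂ (refl , refl)) = sym ends-merged

      forest′ : Forest n A′
      forest′ = forest ∘ bridge-acyclic (Adj n A) (Adj n A′) c u v cross inner (Adj-∪-⁅⁆ n A e)

      crossWeight≡ : crossWeight c (ends n e) ≡ mergedWeight
      crossWeight≡ with c u ≟ c v
      ... | yes p = contradiction p cross
      ... | no _  = refl

      -- The chosen edge is free, so its weight is one summand of the potential.
      mergedWeight≤ : mergedWeight ≤ 12 * (n * n)
      mergedWeight≤ = begin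
        mergedWeight                                     ≡⟨ crossWeight≡ ⟨
        crossWeight c (ends n e)                         ≡⟨ *-identityˡ _ ⟨
        1 * crossWeight c (ends n e)                     ≡⟨ cong (λ k → (if k then 1 else 0) * crossWeight c (ends n e)) ([]=⇒lookup e∈) ⟨
        χ (Free n A E) e * crossWeight c (ends n e)      ≤⟨ term≤sum (λ f → χ (Free n A E) f * crossWeight c (ends n f)) e ⟩
        crossPotential c (Free n A E)                    ≤⟨ m≤m+n _ _ ⟩
        potential c (Free n A E)                         ≤⟨ potential≤ ⟩
        12 * (n * n)                                     ∎
        where open ≤-Reasoning

      -- The three terms, per unit of `mergedWeight`: edges wasted inside classes, growth of the
      -- cross potential, and growth of 4n times the total weight.
      cost≤ : totalWeight c + 2 * (mergedSize * totalWeight c) + 4 * n * mergedSize ≤ b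
      cost≤ = begin
        totalWeight c + 2 * (mergedSize * totalWeight c) + 4 * n * mergedSize
          ≤⟨ +-monoˡ-≤ _ (+-mono-≤ totalWeight≤ (*-monoʳ-≤ 2 (*-monoʳ-≤ mergedSize totalWeight≤))) ⟩
        3 * n + 2 * (mergedSize * (3 * n)) + 4 * n * mergedSize
          ≡⟨ lemma n mergedSize ⟩
        3 * n + 10 * (n * mergedSize)
          ≤⟨ cheap mergedSize (≤-trans (≤-reflexive (sym mergedWeight≡)) mergedWeight≤) ⟩
        b ∎
        where
        open ≤-Reasoning
        lemma : ∀ n k → 3 * n + 2 * (k * (3 * n)) + 4 * n * k ≡ 3 * n + 10 * (n * k)
        lemma = solve-∀

      potential-decreases : ∀ S → S ⊆ Free n A′ E → b ≤ ∣ S ∣ →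
        potential c′ (Free n A′ (E ∪ S)) ≤ potential c (Free n A E)
      potential-decreases S S⊆ b≤S = +-cancelʳ-≤ (mergedWeight * b) _ _ (begin
        Φ′ + 4 * n * totalWeight c′ + mergedWeight * b
          ≤⟨ +-mono-≤ (+-monoʳ-≤ Φ′ (*-monoʳ-≤ (4 * n) totalWeight-merge)) (*-monoʳ-≤ mergedWeight b≤S) ⟩
        Φ′ + 4 * n * (totalWeight c + mergedWeight * mergedSize) + mergedWeight * ∣ S ∣
          ≡⟨ lemma₁ Φ′ (4 * n) (totalWeight c) mergedWeight mergedSize ∣ S ∣ ⟩
        (Φ′ + mergedWeight * ∣ S ∣) + 4 * n * (totalWeight c + mergedWeight * mergedSize)
          ≤⟨ +-monoˡ-≤ _ (crossPotential-merge c u v cross (Free n A E) (Free n A′ (E ∪ S)) S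
               (χ-Free n A A′ E S (p⊆p∪q ⁅ e ⁆) S⊆)
               (λ f f∈ ≢ → ≤-trans (≤-reflexive (sym crossWeight≡)) (least f (f∈ , ≢)))) ⟩
        (Φ + mergedWeight * (totalWeight c + 2 * (mergedSize * totalWeight c))) + 4 * n * (totalWeight c + mergedWeight * mergedSize)
          ≡⟨ lemma₂ Φ (4 * n) (totalWeight c) mergedWeight mergedSize ⟩
        Φ + 4 * n * totalWeight c + mergedWeight * (totalWeight c + 2 * (mergedSize * totalWeight c) + 4 * n * mergedSize)
          -- Enforcer's `b` edges pay for the whole cost of the merge.
          ≤⟨ +-monoʳ-≤ (Φ + 4 * n * totalWeight c) (*-monoʳ-≤ mergedWeight cost≤) ⟩
        Φ + 4 * n * totalWeight c + mergedWeight * b ∎)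
        where
        open ≤-Reasoning
        Φ Φ′ : ℕ
        Φ  = crossPotential c (Free n A E)
        Φ′ = crossPotential c′ (Free n A′ (E ∪ S))
        lemma₁ : ∀ f a w p k s → f + a * (w + p * k) + p * s ≡ (f + p * s) + a * (w + p * k)
        lemma₁ = solve-∀
        lemma₂ : ∀ f a w p k → (f + p * (w + 2 * (k * w))) + a * (w + p * k) ≡ f + a * w + p * (w + 2 * (k * w) + a * k)
        lemma₂ = solve-∀

      safe′ : ∀ S → S ⊆ Free n A′ E → b ≤ ∣ S ∣ → Safe A′ (E ∪ S) c′
      safe′ S S⊆ b≤S = record
        { inner      = inner′
        ; forest     = forest′
        ; potential≤ = ≤-trans (potential-decreases S S⊆ b≤S) potential≤
        }

      free-decreases : ∀ S → ∣ Free n A′ (E ∪ S) ∣ < ∣ Free n A E ∣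
      free-decreases S = p⊂q⇒∣p∣<∣q∣ {p = Free n A′ (E ∪ S)} {q = Free n A E}
        ( Free-antitone n {A′ = A′} (p⊆p∪q ⁅ e ⁆) (p⊆p∪q S)
        , e , e∈ , λ e∈′ → proj₁ (∈Free⁻ n {A = A′} {E = E ∪ S} e∈′) (q⊆p∪q A ⁅ e ⁆ (x∈⁅x⁆ e)) )

  -- Recursion on a strict bound `m` for the number of free edges, which drops every round since `e`
  -- is taken.
  play : ∀ m {A E c} → ∣ Free n A E ∣ < m → Safe A E c →
    AvoiderForces n variant b (ForestPlusOne n) A E avoider
  play (suc m) {A} {E} {c} (s≤s F≤m) safe with nonempty? (Free n A E)
  ... | no none = finished none (forest⇒forestPlusOne n (Safe.forest safe))
  ... | yes (e₀ , e₀∈) with argmin cross? (λ e → crossWeight c (ends n e))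
    where
    cross? : Decidable (λ e → e ∈ Free n A E × c (proj₁ (ends n e)) ≢ c (proj₂ (ends n e)))
    cross? e = (e ∈? Free n A E) ×-dec ¬? (c (proj₁ (ends n e)) ≟ c (proj₂ (ends n e)))
  ...   | inj₂ none = last-round safe e₀∈ (inner-free<b safe none)
  ...   | inj₁ (e , (e∈ , cross) , least) =
    avMove (e , e∈) ⁅ e ⁆ (singleton-legal n variant {A} {E} e∈) respond
    where
    open Joining safe e e∈ cross least
    respond : AvoiderForces n variant b (ForestPlusOne n) A′ E enforcer
    respond with nonempty? (Free n A′ E)
    ... | no  none = finished none (forest⇒forestPlusOne n forest′)
    ... | yes some = enfMove some λ S legal → continue S (enforcer-claims n variant legal)
      where
      continue : ∀ S → S ⊆ Free n A′ E × (Free n A′ E ⊆ S ⊎ (b ≤ ∣ Free n A′ E ∣ × b ≤ ∣ S ∣)) →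
        AvoiderForces n variant b (ForestPlusOne n) A′ (E ∪ S) avoider
      continue S (_ , inj₁ F⊆S)        = finished (claim-all n {A = A′} F⊆S) (forest⇒forestPlusOne n forest′)
      continue S (S⊆ , inj₂ (_ , b≤S)) = play m (<-≤-trans (free-decreases S) F≤m) (safe′ S S⊆ b≤S)

  -- The initial position.

  size-id : ∀ {m} (x : Fin m) → size id x ≤ 1
  size-id {suc m} zero    = s≤s (≤-trans (sum-≤-const {n = m} {a = 0} λ _ → ≤-refl) (≤-reflexive (*-zeroʳ m)))
  size-id {suc m} (suc x) = size-id x

  weight-id : ∀ (x : Fin n) → weight id x ≤ 2
  weight-id x = ^-monoʳ-≤ 2 (size-id x)

  crossWeight-id : ∀ (p : Fin n × Fin n) → crossWeight id p ≤ 4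
  crossWeight-id (x , y) with x ≟ y
  ... | yes _ = z≤n
  ... | no  _ = *-mono-≤ (weight-id x) (weight-id y)

  crossPotential-id : ∀ F → crossPotential {n} id F ≤ n * (n * 4)
  crossPotential-id F = begin
    crossPotential {n} id F                                  ≤⟨ sum-mono-≤ pointwise ⟩
    ∑[ e < M n ] crossWeight id (ends n e)               ≤⟨ sum-ends n (crossWeight id) ⟩
    ∑[ x < n ] ∑[ y < n ] crossWeight id (x , y)         ≤⟨ sum-≤-const (λ x → sum-≤-const (λ y → crossWeight-id (x , y))) ⟩
    n * (n * 4)                                          ∎
    where
    open ≤-Reasoning
    pointwise : ∀ e → χ F e * crossWeight id (ends n e) ≤ crossWeight id (ends n e)
    pointwise e with Vec.lookup F e
    ... | true  = ≤-reflexive (+-identityʳ _)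
    ... | false = z≤n

  ∅-no-adj : ∀ {x y} → ¬ Adj n ∅ x y
  ∅-no-adj (_ , e∈ , _) = ∉⊥ e∈

  -- Singletons have weight 2, so the cross potential is at most 4n² and the other term at most 8n².
  safe-start : Safe ∅ ∅ id
  safe-start = record
    { inner      = λ adj → contradiction adj ∅-no-adj
    ; forest     = λ { (_ , [] , () , _) ; (_ , _ ∷ _ , _ , _ , adj ∷ _) → ∅-no-adj adj }
    ; potential≤ = ≤-trans
        (+-mono-≤ (crossPotential-id (Free n ∅ ∅)) (*-monoʳ-≤ (4 * n) (sum-≤-const weight-id)))
        (≤-reflexive (lemma n))
    }
    where
    lemma : ∀ n → n * (n * 4) + 4 * n * (n * 2) ≡ 12 * (n * n)
    lemma = solve-∀

  avoider-ensures : AvoiderCanEnsure n variant b (ForestPlusOne n)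
  avoider-ensures = play (suc ∣ Free n ∅ ∅ ∣) ≤-refl safe-start

-- The bias suffices, and the conclusion.

bias-covers-cost : ∀ {n b} → 12 ≤ n → BiasAtLeast200nlnn n b →
  ∀ k → 2 ^ k ≤ 12 * (n * n) → 3 * n + 10 * (n * k) ≤ b
bias-covers-cost {n} {b} 12≤n bias k 2^k≤ = *-cancelˡ-≤ 6 (begin
  -- `bias-log` at 1 and at `k` gives 100n + 100nk ≤ 6b; the added term is the slack over 18n +
  -- 60nk.
  6 * (3 * n + 10 * (n * k))           ≤⟨ m≤m+n _ (82 * n + 40 * (n * k)) ⟩
  6 * (3 * n + 10 * (n * k)) + (82 * n + 40 * (n * k))
                                       ≡⟨ lemma n k ⟩
  1 * (100 * n) + k * (100 * n)        ≤⟨ +-mono-≤ (bias-log {n} bias 1 2≤n³) (bias-log {n} bias k 2^k≤n³) ⟩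
  3 * b + 3 * b                        ≡⟨ lemma′ b ⟩
  6 * b                                ∎)
  where
  open ≤-Reasoning
  lemma : ∀ n k → 6 * (3 * n + 10 * (n * k)) + (82 * n + 40 * (n * k)) ≡ 1 * (100 * n) + k * (100 * n)
  lemma = solve-∀
  lemma′ : ∀ b → 3 * b + 3 * b ≡ 6 * b
  lemma′ = solve-∀
  2^k≤n³ : 2 ^ k ≤ n ^ 3
  2^k≤n³ = ≤-trans 2^k≤ (*-mono-≤ 12≤n (*-monoʳ-≤ n (≤-reflexive (sym (*-identityʳ n)))))
  2≤n³ : 2 ^ 1 ≤ n ^ 3
  -- 2 + 1726 = 12^3.
  2≤n³ = ≤-trans (m≤m+n 2 1726) (^-monoˡ-≤ 3 12≤n)

theorem1p1 : ∃[ n₀ ] ((n b : ℕ) → n₀ ≤ n → BiasAtLeast200nlnn n b →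
    AvoiderCanEnsure n monotone b (ForestPlusOne n) ×
    AvoiderCanEnsure n strict b (ForestPlusOne n))
-- From 12 on, 12n² ≤ n³, so component sizes fall within the range of `bias-log`.
theorem1p1 = 12 , λ n b 12≤n bias →
  let instance
        n≢0 : NonZero n
        n≢0 = >-nonZero (<-≤-trans 0<1+n 12≤n)
      cheap = bias-covers-cost {n} 12≤n bias
      1≤n*n = *-mono-≤ (>-nonZero⁻¹ n) (>-nonZero⁻¹ n)
      0<10n = *-mono-≤ {1} {10} 0<1+n (*-mono-≤ (>-nonZero⁻¹ n) (≤-refl {1}))
      -- The cost bound at k = 1 reads 3n + 10n ≤ b.
      3n<b = <-≤-trans (m<m+n (3 * n) 0<10n) (cheap 1 (≤-trans (m≤m+n 2 10) (*-monoʳ-≤ 12 1≤n*n)))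
  in Strategy.avoider-ensures monotone 3n<b cheap , Strategy.avoider-ensures strict 3n<b cheap
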